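{- For every integer $m\geqslant 0$ and every vector $A=(a_1,a_2,\dots,a_m)$ with non-negative integer coordinates (with $A=\emptyset$ if $m=0$), the polynomial $\Delta(A;t)\in\mathbb{Z}[t]$ is a $3$-special polynomial.
   Context: The polynomial $\Delta(A;t)=\Delta(a_1,\dots,a_m;t)\in\mathbb{Z}[t]$ is defined recursively by $\Delta(\emptyset;t):=1$, $\Delta(0;t):=0$, $\Delta(a;t):=t+t^2+\dots+t^a$ for integers $a>0$, and for $m\geqslant 2$ $$\Delta(a_1,\dots,a_m;t):=\Delta(a_1,\dots,a_{m-1};t)\cdot\Delta(a_m;t)-\Delta(a_1,\dots,a_{m-2};t)\cdot t^{a_m+1},$$ where for $m=2$ the expression $\Delta(a_1,\dots,a_{m-2};t)$ means $\Delta(\emptyset;t)=1$. Let $K:=\mathbb{Z}[T]/(T^3-1)$. For $g(t)=\sum_{h\geqslant 0}a_ht^h\in\mathbb{Z}[t]$ and $i\in\{0,1,2\}$ put $R_i(g(t)):=\sum_{h\equiv i \bmod 3}a_h$, and define $R:\mathbb{Z}[t]\to K$ by $R(g(t)):=R_0(g(t))+R_1(g(t))T+R_2(g(t))T^2$. An element $a+bT+cT^2\in K$ (with $a,b,c\in\mathbb{Z}$) is called special if either $a=b=c$, or $|a-b|+|a-c|+|b-c|=2$. A polynomial $g(t)\in\mathbb{Z}[t]$ is called $3$-special if $R(g(t))$ is a special element of $K$. -}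

module Defs where

open import Data.Bool.Base using (if_then_else_)
open import Data.Fin.Base using (Fin; zero; suc)
open import Data.Fin.Properties using (_≟_)
open import Data.Integer.Base as ℤ using (ℤ; 0ℤ; 1ℤ; ∣_∣)
open import Data.List.Base using (List; []; _∷_; map; replicate; _++_)
open import Data.Nat.Base as ℕ using (ℕ; zero; suc)
open import Data.Nat.DivMod using (_mod_)
open import Data.Product.Base using (_×_; ∃-syntax)
open import Data.Sum.Base using (_⊎_)
open import Data.Vec.Base using (Vec; []; _∷_; init; last)
open import Relation.Binary.PropositionalEquality.Core using (_≡_)
open import Relation.Nullary.Decidable.Core using (does)

infix  4 _≈_ _≈K_
infixl 6 _+ₚ_ _-ₚ_
infixl 7 _*ₚ_ _·ₚ_

-- Integer polynomials in one variable as coefficient lists, constant term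
-- first.  Trailing zeros are allowed, so equality of polynomials is _≈_.
Poly : Set
Poly = List ℤ

coeff : Poly → ℕ → ℤ
coeff []      _       = 0ℤ
coeff (a ∷ p) zero    = a
coeff (a ∷ p) (suc h) = coeff p h

_≈_ : Poly → Poly → Set
p ≈ q = ∀ h → coeff p h ≡ coeff q h

0ₚ 1ₚ : Poly
0ₚ = []
1ₚ = 1ℤ ∷ []

var^ : ℕ → Poly
var^ n = replicate n 0ℤ ++ 1ₚ

_+ₚ_ : Poly → Poly → Poly
[]      +ₚ q       = q
(a ∷ p) +ₚ []      = a ∷ p
(a ∷ p) +ₚ (b ∷ q) = a ℤ.+ b ∷ p +ₚ q

_·ₚ_ : ℤ → Poly → Poly
a ·ₚ p = map (a ℤ.*_) p

_-ₚ_ : Poly → Poly → Poly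
p -ₚ q = p +ₚ map ℤ.-_ q

_*ₚ_ : Poly → Poly → Poly
[]      *ₚ q = 0ₚ
(a ∷ p) *ₚ q = a ·ₚ q +ₚ (0ℤ ∷ p *ₚ q)

-- t + t² + … + tᵃ, the empty sum being 0.
Δ₁ : ℕ → Poly
Δ₁ zero    = 0ₚ
Δ₁ (suc a) = Δ₁ a +ₚ var^ (suc a)

Δ : ∀ {m} → Vec ℕ m → Poly
Δ {zero}        []       = 1ₚ
Δ {suc zero}    (a ∷ []) = Δ₁ a
Δ {suc (suc m)} A        =
  Δ (init A) *ₚ Δ₁ (last A) -ₚ Δ (init (init A)) *ₚ var^ (last A ℕ.+ 1)

-- K = ℤ[T]/(T³ - 1) is the setoid of polynomials in T under congruence
-- modulo the ideal generated by T³ - 1.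
K : Set
K = Poly

_≈K_ : K → K → Set
x ≈K y = ∃[ q ] x -ₚ y ≈ (var^ 3 -ₚ 1ₚ) *ₚ q

⟨_+_T+_T²⟩ : ℤ → ℤ → ℤ → K
⟨ a + b T+ c T²⟩ = a ∷ b ∷ c ∷ []

-- The argument h is the exponent carried by the head of the list.
residueSumFrom : ℕ → Fin 3 → Poly → ℤ
residueSumFrom h i []      = 0ℤ
residueSumFrom h i (a ∷ g) =
  (if does (h mod 3 ≟ i) then a else 0ℤ) ℤ.+ residueSumFrom (suc h) i g

residueSum : Fin 3 → Poly → ℤ
residueSum = residueSumFrom 0

R : Poly → K
R g = ⟨ residueSum zero g + residueSum (suc zero) g T+ residueSum (suc (suc zero)) g T²⟩

-- Since T³ - 1 is monic of degree 3, the integers a, b, c are determined by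
-- the class of x in K.
Special : K → Set
Special x = ∃[ a ] ∃[ b ] ∃[ c ] x ≈K ⟨ a + b T+ c T²⟩ ×
  ((a ≡ b × b ≡ c) ⊎ ∣ a ℤ.- b ∣ ℕ.+ ∣ a ℤ.- c ∣ ℕ.+ ∣ b ℤ.- c ∣ ≡ 2)

3-Special : Poly → Set
3-Special g = Special (R g)

{-# OPTIONS --safe #-}

-- Modulo 1 + T + T² the ring K becomes the Eisenstein integers ℤ[ω], and an
-- element of K is special exactly when its image is zero or one of the six
-- units.  So it suffices to follow the value of Δ at t = ω.  Consecutive values
-- form a pair (x , y) that starts at (1 , 0) and moves by
--   (x , y) ↦ (x d − y e , x),
-- where (d , e), the value of (t + … + tᵃ , tᵃ⁺¹) at ω, depends only on a mod 3.
-- The orbit of (1 , 0) is finite: it consists of the unit multiples of (1 , 0),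
-- (0 , 1), (ω , 1) and (−1 , 1), and its first coordinates are zero or units.
module Submission where

open import Defs
open import Data.Bool.Base using (if_then_else_)
open import Data.Fin.Base using (Fin; zero; suc)
import Data.Fin.Properties as Fin
open import Data.Integer.Base using (ℤ; 0ℤ; 1ℤ; ∣_∣; _+_; _-_; _*_; -_)
import Data.Integer.Properties as ℤ
open import Data.Integer.Tactic.RingSolver using (solve-∀)
open import Data.List.Base using (List; []; _∷_; map; cartesianProductWith)
import Data.List.Membership.DecPropositional as DecMembership
open import Data.List.Membership.Propositional using (_∈_)
open import Data.List.Relation.Unary.All using (All; all?; lookup)
open import Data.List.Relation.Unary.Any using (here)
import Data.Nat.Base as ℕ
open import Data.Nat.Base using (ℕ; zero; suc)
open import Data.Nat.DivMod using (_mod_)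
import Data.Nat.Properties as ℕ
open import Data.Product.Base using (_×_; _,_; proj₁)
open import Data.Product.Properties using (≡-dec)
open import Data.Sum.Base using (_⊎_; inj₁; inj₂)
open import Data.Vec.Base using (Vec; []; _∷_; init; last)
open import Relation.Binary.Definitions using (DecidableEquality)
open import Relation.Binary.PropositionalEquality
  using (_≡_; refl; sym; trans; cong; cong₂; subst; module ≡-Reasoning)
open import Relation.Nullary.Decidable using (Dec; does; from-yes; _×-dec_; _⊎-dec_)
open ≡-Reasoning

-- Eisenstein integers and evaluation of polynomials at ω.

infixl 6 _⊕_ _⊝_
infixl 7 _⊛_

-- (x , y) stands for x + y ω, where ω² = −1 − ω.
ℤ[ω] : Set
ℤ[ω] = ℤ × ℤ

_≟_ : DecidableEquality ℤ[ω]
_≟_ = ≡-dec ℤ._≟_ ℤ._≟_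

0ω 1ω ω : ℤ[ω]
0ω = 0ℤ , 0ℤ
1ω = 1ℤ , 0ℤ
ω  = 0ℤ , 1ℤ

_⊕_ _⊝_ _⊛_ : ℤ[ω] → ℤ[ω] → ℤ[ω]
(a , b) ⊕ (c , d) = a + c , b + d
(a , b) ⊝ (c , d) = a - c , b - d
(a , b) ⊛ (c , d) = a * c - b * d , a * d + b * c - b * d

-- This is a + ω z, since ω (x + y ω) = -y + (x - y) ω.
horner : ℤ → ℤ[ω] → ℤ[ω]
horner a (x , y) = a - y , x - y

eval : Poly → ℤ[ω]
eval []      = 0ω
eval (a ∷ p) = horner a (eval p)

horner-0 : ∀ z → horner 0ℤ z ≡ ω ⊛ z
horner-0 (x , y) = cong₂ _,_ (fst x y) (snd x y)
  where
  fst : ∀ x y → 0ℤ - y ≡ 0ℤ * x - 1ℤ * y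
  fst = solve-∀
  snd : ∀ x y → x - y ≡ 0ℤ * y + 1ℤ * x - 1ℤ * y
  snd = solve-∀

horner-⊕ : ∀ a b z w → horner (a + b) (z ⊕ w) ≡ horner a z ⊕ horner b w
horner-⊕ a b (x , y) (u , v) = cong₂ _,_ (interchange a b y v) (interchange x u y v)
  where
  interchange : ∀ a b c d → (a + b) - (c + d) ≡ (a - c) + (b - d)
  interchange = solve-∀

⊕-identityʳ : ∀ z → z ⊕ 0ω ≡ z
⊕-identityʳ (x , y) = cong₂ _,_ (ℤ.+-identityʳ x) (ℤ.+-identityʳ y)

⊕-identityˡ : ∀ z → 0ω ⊕ z ≡ z
⊕-identityˡ (x , y) = cong₂ _,_ (ℤ.+-identityˡ x) (ℤ.+-identityˡ y)

eval-+ : ∀ p q → eval (p +ₚ q) ≡ eval p ⊕ eval q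
eval-+ []      q       = sym (⊕-identityˡ (eval q))
eval-+ (a ∷ p) []      = sym (⊕-identityʳ (eval (a ∷ p)))
eval-+ (a ∷ p) (b ∷ q) = begin
  horner (a + b) (eval (p +ₚ q))       ≡⟨ cong (horner (a + b)) (eval-+ p q) ⟩
  horner (a + b) (eval p ⊕ eval q)     ≡⟨ horner-⊕ a b (eval p) (eval q) ⟩
  eval (a ∷ p) ⊕ eval (b ∷ q)          ∎

⊛-zeroˡ : ∀ z → 0ω ⊛ z ≡ 0ω
⊛-zeroˡ (x , y) = cong₂ _,_ (fst x y) (snd x y)
  where
  fst : ∀ x y → 0ℤ * x - 0ℤ * y ≡ 0ℤ
  fst = solve-∀
  snd : ∀ x y → 0ℤ * y + 0ℤ * x - 0ℤ * y ≡ 0ℤ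
  snd = solve-∀

⊛-zeroʳ : ∀ z → z ⊛ 0ω ≡ 0ω
⊛-zeroʳ (x , y) = cong₂ _,_ (fst x y) (snd x y)
  where
  fst : ∀ x y → x * 0ℤ - y * 0ℤ ≡ 0ℤ
  fst = solve-∀
  snd : ∀ x y → x * 0ℤ + y * 0ℤ - y * 0ℤ ≡ 0ℤ
  snd = solve-∀

⊛-identityˡ : ∀ z → 1ω ⊛ z ≡ z
⊛-identityˡ (x , y) = cong₂ _,_ (fst x y) (snd x y)
  where
  fst : ∀ x y → 1ℤ * x - 0ℤ * y ≡ x
  fst = solve-∀
  snd : ∀ x y → 1ℤ * y + 0ℤ * x - 0ℤ * y ≡ y
  snd = solve-∀

⊝-identityʳ : ∀ z → z ⊝ 0ω ≡ z
⊝-identityʳ (x , y) = cong₂ _,_ (ℤ.+-identityʳ x) (ℤ.+-identityʳ y)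

⊕-⊝ : ∀ z w → z ⊕ (0ω ⊝ w) ≡ z ⊝ w
⊕-⊝ (x , y) (u , v) =
  cong₂ _,_ (cong (x +_) (ℤ.+-identityˡ (- u))) (cong (y +_) (ℤ.+-identityˡ (- v)))

horner-⊝ : ∀ a z → horner (- a) (0ω ⊝ z) ≡ 0ω ⊝ horner a z
horner-⊝ a (x , y) = cong₂ _,_ (fst a y) (snd x y)
  where
  fst : ∀ a y → - a - (0ℤ - y) ≡ 0ℤ - (a - y)
  fst = solve-∀
  snd : ∀ x y → (0ℤ - x) - (0ℤ - y) ≡ 0ℤ - (x - y)
  snd = solve-∀

horner-· : ∀ a b z → horner (a * b) ((a , 0ℤ) ⊛ z) ≡ (a , 0ℤ) ⊛ horner b z
horner-· a b (x , y) = cong₂ _,_ (fst a b x y) (snd a b x y)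
  where
  fst : ∀ a b x y → a * b - (a * y + 0ℤ * x - 0ℤ * y) ≡ a * (b - y) - 0ℤ * (x - y)
  fst = solve-∀
  snd : ∀ a b x y → (a * x - 0ℤ * y) - (a * y + 0ℤ * x - 0ℤ * y)
                  ≡ a * (x - y) + 0ℤ * (b - y) - 0ℤ * (x - y)
  snd = solve-∀

-- The identity a w + ω (z w) = (a + ω z) w, in the shape of the recursion of `_*ₚ_`; it is the
-- inductive step for multiplicativity of `eval`.
horner-⊛ : ∀ a z w → (a , 0ℤ) ⊛ w ⊕ horner 0ℤ (z ⊛ w) ≡ horner a z ⊛ w
horner-⊛ a (x , y) (u , v) = cong₂ _,_ (fst a x y u v) (snd a x y u v)
  where
  fst : ∀ a x y u v → (a * u - 0ℤ * v) + (0ℤ - (x * v + y * u - y * v))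
                    ≡ (a - y) * u - (x - y) * v
  fst = solve-∀
  snd : ∀ a x y u v → (a * v + 0ℤ * u - 0ℤ * v) + ((x * u - y * v) - (x * v + y * u - y * v))
                    ≡ (a - y) * v + (x - y) * u - (x - y) * v
  snd = solve-∀

eval-· : ∀ a p → eval (a ·ₚ p) ≡ (a , 0ℤ) ⊛ eval p
eval-· a []      = sym (⊛-zeroʳ (a , 0ℤ))
eval-· a (b ∷ p) = begin
  horner (a * b) (eval (a ·ₚ p))           ≡⟨ cong (horner (a * b)) (eval-· a p) ⟩
  horner (a * b) ((a , 0ℤ) ⊛ eval p)       ≡⟨ horner-· a b (eval p) ⟩
  (a , 0ℤ) ⊛ eval (b ∷ p)                  ∎

eval-neg : ∀ p → eval (map -_ p) ≡ 0ω ⊝ eval p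
eval-neg []      = refl
eval-neg (a ∷ p) = begin
  horner (- a) (eval (map -_ p))     ≡⟨ cong (horner (- a)) (eval-neg p) ⟩
  horner (- a) (0ω ⊝ eval p)         ≡⟨ horner-⊝ a (eval p) ⟩
  0ω ⊝ eval (a ∷ p)                  ∎

eval-- : ∀ p q → eval (p -ₚ q) ≡ eval p ⊝ eval q
eval-- p q = begin
  eval (p +ₚ map -_ q)          ≡⟨ eval-+ p (map -_ q) ⟩
  eval p ⊕ eval (map -_ q)      ≡⟨ cong (eval p ⊕_) (eval-neg q) ⟩
  eval p ⊕ (0ω ⊝ eval q)        ≡⟨ ⊕-⊝ (eval p) (eval q) ⟩
  eval p ⊝ eval q               ∎

eval-* : ∀ p q → eval (p *ₚ q) ≡ eval p ⊛ eval q
eval-* []      q = sym (⊛-zeroˡ (eval q))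
eval-* (a ∷ p) q = begin
  eval (a ·ₚ q +ₚ (0ℤ ∷ p *ₚ q))
    ≡⟨ eval-+ (a ·ₚ q) (0ℤ ∷ p *ₚ q) ⟩
  eval (a ·ₚ q) ⊕ horner 0ℤ (eval (p *ₚ q))
    ≡⟨ cong₂ (λ z w → z ⊕ horner 0ℤ w) (eval-· a q) (eval-* p q) ⟩
  (a , 0ℤ) ⊛ eval q ⊕ horner 0ℤ (eval p ⊛ eval q)
    ≡⟨ horner-⊛ a (eval p) (eval q) ⟩
  eval (a ∷ p) ⊛ eval q ∎

-- Residue sums modulo 3.

next : Fin 3 → Fin 3
next zero             = suc zero
next (suc zero)       = suc (suc zero)
next (suc (suc zero)) = zero

mod-next : ∀ h i → does (suc h mod 3 Fin.≟ next i) ≡ does (h mod 3 Fin.≟ i)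
mod-next 0 zero                         = refl
mod-next 0 (suc zero)                   = refl
mod-next 0 (suc (suc zero))             = refl
mod-next 1 zero                         = refl
mod-next 1 (suc zero)                   = refl
mod-next 1 (suc (suc zero))             = refl
mod-next 2 zero                         = refl
mod-next 2 (suc zero)                   = refl
mod-next 2 (suc (suc zero))             = refl
-- The remainder computation returns to its initial state after three successors, so the goal
-- reduces to the one for `h`.
mod-next (suc (suc (suc h))) i          = mod-next h i

-- Raising every exponent by one rotates the residue classes. This relates the tail of a list, whose
-- exponents start at 1, to the same list read from exponent 0.
residueSumFrom-next : ∀ h i g → residueSumFrom (suc h) (next i) g ≡ residueSumFrom h i g
residueSumFrom-next h i []      = refl
residueSumFrom-next h i (a ∷ g) =
  cong₂ (λ b s → (if b then a else 0ℤ) + s) (mod-next h i) (residueSumFrom-next (suc h) i g)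

-- ω² = −1 − ω turns r₀ + r₁ ω + r₂ ω² into (r₀ − r₂) + (r₁ − r₂) ω.
eval-residueSum : ∀ g → eval g ≡ ( residueSum zero g - residueSum (suc (suc zero)) g
                                 , residueSum (suc zero) g - residueSum (suc (suc zero)) g )
eval-residueSum []      = refl
eval-residueSum (a ∷ g) = begin
  horner a (eval g)
    ≡⟨ cong (horner a) (eval-residueSum g) ⟩
  horner a (r₀ - r₂ , r₁ - r₂)
    ≡⟨ cong₂ _,_ (fst a r₁ r₂) (snd r₀ r₁ r₂) ⟩
  -- The head has exponent 0 and counts only in class 0, whence the two forms `a +` and `0ℤ +`;
  -- classes 2, 0, 1 of the tail move to 0, 1, 2.
  ((a + r₂) - (0ℤ + r₁) , (0ℤ + r₀) - (0ℤ + r₁))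
    ≡⟨ cong₂ _,_ (cong₂ (λ s t → (a + s) - (0ℤ + t)) (shift (suc (suc zero))) (shift (suc zero)))
                 (cong₂ (λ s t → (0ℤ + s) - (0ℤ + t)) (shift zero) (shift (suc zero))) ⟩
  _ ∎
  where
  r₀ = residueSum zero g
  r₁ = residueSum (suc zero) g
  r₂ = residueSum (suc (suc zero)) g
  shift : ∀ i → residueSum i g ≡ residueSumFrom 1 (next i) g
  shift i = sym (residueSumFrom-next 0 i g)
  fst : ∀ a y z → a - (y - z) ≡ (a + z) - (0ℤ + y)
  fst = solve-∀
  snd : ∀ x y z → (x - z) - (y - z) ≡ (0ℤ + x) - (0ℤ + y)
  snd = solve-∀

-- Special elements via zeros and units.

ZeroOrUnit : ℤ[ω] → Set
ZeroOrUnit (x , y) = (x ≡ 0ℤ × y ≡ 0ℤ) ⊎ ∣ x - y ∣ ℕ.+ ∣ x ∣ ℕ.+ ∣ y ∣ ≡ 2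

zeroOrUnit? : ∀ z → Dec (ZeroOrUnit z)
zeroOrUnit? (x , y) =
  (x ℤ.≟ 0ℤ ×-dec y ℤ.≟ 0ℤ) ⊎-dec ∣ x - y ∣ ℕ.+ ∣ x ∣ ℕ.+ ∣ y ∣ ℕ.≟ 2

≈K-refl : ∀ a b c → ⟨ a + b T+ c T²⟩ ≈K ⟨ a + b T+ c T²⟩
≈K-refl a b c = 0ₚ , λ where
  0                          → ℤ.+-inverseʳ a
  1                          → ℤ.+-inverseʳ b
  2                          → ℤ.+-inverseʳ c
  -- Multiplying by the empty list leaves four explicit zeros, so index 3 still meets an entry and
  -- only larger indices run off the end.
  3                          → refl
  (suc (suc (suc (suc _))))  → refl

-- With x = a - c and y = b - c, the difference x - y telescopes to a - b, so both alternatives of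
-- `ZeroOrUnit` become those of `Special`.
zeroOrUnit⇒special : ∀ a b c → ZeroOrUnit (a - c , b - c) → Special ⟨ a + b T+ c T²⟩
zeroOrUnit⇒special a b c z = a , b , c , ≈K-refl a b c , shape z
  where
  telescope : ∀ a b c → (a - c) - (b - c) ≡ a - b
  telescope = solve-∀
  shape : ZeroOrUnit (a - c , b - c) →
          (a ≡ b × b ≡ c) ⊎ ∣ a - b ∣ ℕ.+ ∣ a - c ∣ ℕ.+ ∣ b - c ∣ ≡ 2
  shape (inj₁ (a-c≡0 , b-c≡0)) = inj₁ (trans (ℤ.i-j≡0⇒i≡j a c a-c≡0) (sym b≡c) , b≡c)
    where b≡c = ℤ.i-j≡0⇒i≡j b c b-c≡0
  shape (inj₂ eq) =
    inj₂ (subst (λ d → ∣ d ∣ ℕ.+ ∣ a - c ∣ ℕ.+ ∣ b - c ∣ ≡ 2) (telescope a b c) eq)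

zeroOrUnit⇒3-special : ∀ g → ZeroOrUnit (eval g) → 3-Special g
zeroOrUnit⇒3-special g z =
  zeroOrUnit⇒special r₀ r₁ r₂ (subst ZeroOrUnit (eval-residueSum g) z)
  where
  r₀ = residueSum zero g
  r₁ = residueSum (suc zero) g
  r₂ = residueSum (suc (suc zero)) g

-- The finite transition system.

Pair : Set
Pair = ℤ[ω] × ℤ[ω]

open DecMembership (≡-dec _≟_ _≟_) using (_∈?_)

letter : ℕ → Pair
letter a = eval (Δ₁ a) , eval (var^ (suc a))

-- From a to a + 1 the sum gains the term tᵃ⁺¹, whose value is `e`, so the new letter depends on the
-- old one alone.
nextLetter : Pair → Pair
nextLetter (d , e) = d ⊕ e , ω ⊛ e

-- The values for a ≡ 0, 1, 2 mod 3; the cycle closes because 1 + ω + ω² = 0.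
letters : List Pair
letters = (0ω , ω) ∷ (ω , ω ⊛ ω) ∷ (ω ⊕ ω ⊛ ω , 1ω) ∷ []

nextLetter-closed : All (λ l → nextLetter l ∈ letters) letters
nextLetter-closed = from-yes (all? (λ l → nextLetter l ∈? letters) letters)

letter∈letters : ∀ a → letter a ∈ letters
letter∈letters zero    = here refl
letter∈letters (suc a) =
  subst (_∈ letters)
    (sym (cong₂ _,_ (eval-+ (Δ₁ a) (var^ (suc a))) (horner-0 (eval (var^ (suc a))))))
    (lookup nextLetter-closed (letter∈letters a))

step : Pair → Pair → Pair
step (d , e) (x , y) = x ⊛ d ⊝ y ⊛ e , x

units : List ℤ[ω]
units = 1ω ∷ ω ∷ ω ⊛ ω ∷ 0ω ⊝ 1ω ∷ 0ω ⊝ ω ∷ 0ω ⊝ ω ⊛ ω ∷ []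

orbit : List Pair
orbit = cartesianProductWith (λ u (x , y) → u ⊛ x , u ⊛ y) units
  ((1ω , 0ω) ∷ (0ω , 1ω) ∷ (ω , 1ω) ∷ (0ω ⊝ 1ω , 1ω) ∷ [])

-- Each `step l` is linear over ℤ[ω] and, up to units, permutes the four representatives in `orbit`.
-- The 3 · 24 cases are decided by computation.
step-closed : All (λ l → All (λ s → step l s ∈ orbit) orbit) letters
step-closed = from-yes (all? (λ l → all? (λ s → step l s ∈? orbit) orbit) letters)

orbit-zeroOrUnit : All (λ s → ZeroOrUnit (proj₁ s)) orbit
orbit-zeroOrUnit = from-yes (all? (λ s → zeroOrUnit? (proj₁ s)) orbit)

step∈orbit : ∀ a {s} → s ∈ orbit → step (letter a) s ∈ orbit
step∈orbit a = lookup (lookup step-closed (letter∈letters a))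

-- The recursion for Δ as a walk in the orbit.

state : ∀ {m} → Vec ℕ (suc m) → Pair
state A = eval (Δ A) , eval (Δ (init A))

-- A fictitious value 0 placed before Δ(∅) = 1 makes the one-entry case an instance of the general
-- step.
state-singleton : ∀ a → state (a ∷ []) ≡ step (letter a) (1ω , 0ω)
state-singleton a = cong (_, 1ω) (sym (begin
  1ω ⊛ d ⊝ 0ω ⊛ e   ≡⟨ cong₂ _⊝_ (⊛-identityˡ d) (⊛-zeroˡ e) ⟩
  d ⊝ 0ω            ≡⟨ ⊝-identityʳ d ⟩
  d                 ∎))
  where
  d = eval (Δ₁ a)
  e = eval (var^ (suc a))

state-step : ∀ {m} (A : Vec ℕ (suc (suc m))) → state A ≡ step (letter (last A)) (state (init A))
state-step A = cong (_, eval B) (begin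
  eval (B *ₚ Δ₁ a -ₚ C *ₚ var^ (a ℕ.+ 1))
    ≡⟨ cong (λ n → eval (B *ₚ Δ₁ a -ₚ C *ₚ var^ n)) (ℕ.+-comm a 1) ⟩
  eval (B *ₚ Δ₁ a -ₚ C *ₚ var^ (suc a))
    ≡⟨ eval-- (B *ₚ Δ₁ a) (C *ₚ var^ (suc a)) ⟩
  eval (B *ₚ Δ₁ a) ⊝ eval (C *ₚ var^ (suc a))
    ≡⟨ cong₂ _⊝_ (eval-* B (Δ₁ a)) (eval-* C (var^ (suc a))) ⟩
  eval B ⊛ eval (Δ₁ a) ⊝ eval C ⊛ eval (var^ (suc a)) ∎)
  where
  a = last A
  B = Δ (init A)
  C = Δ (init (init A))

state∈orbit : ∀ {m} (A : Vec ℕ (suc m)) → state A ∈ orbit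
state∈orbit {zero}  (a ∷ []) =
  -- The start (1 , 0) is the head of `orbit`: the unit `1ω` times the first representative.
  subst (_∈ orbit) (sym (state-singleton a)) (step∈orbit a (here refl))
state∈orbit {suc m} A        =
  subst (_∈ orbit) (sym (state-step A)) (step∈orbit (last A) (state∈orbit (init A)))

theorem4 : (m : ℕ) (A : Vec ℕ m) → 3-Special (Δ A)
-- The empty vector has no `state`; its value is 1, and ∣1 - 0∣ + ∣1∣ + ∣0∣ = 2.
theorem4 zero    [] = zeroOrUnit⇒3-special 1ₚ (inj₂ refl)
theorem4 (suc m) A  = zeroOrUnit⇒3-special (Δ A) (lookup orbit-zeroOrUnit (state∈orbit A))
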